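{- Let $\mathsf H_{21}$ be the 21-vertex, 14-hyperedge hypergraph defined in the context. Let $$p=\frac{\sqrt{14}+\sqrt2}{4},\qquad q=\frac{\sqrt{14}-\sqrt2}{4}.$$ Assign to the vertices of $\mathsf H_{21}$ the following vectors in $\mathbb C^3$ (denoted by the same symbols as the vertices): $$c=(0,0,1),\quad a_1=(1,1,0),\quad a_2=(1,-1,0),\quad b_1=(1,\mathrm i,0),\quad b_2=(1,-\mathrm i,0),$$ \begin{align*} v_0&=(1,-1,\sqrt2),& v_4&=(1,-1,-\sqrt2),\\ v_1&=(1,\mathrm i,p+\mathrm iq),& v_5&=(1,\mathrm i,-p-\mathrm iq),\\ v_2&=(1,1,-\mathrm i\sqrt2),& v_6&=(1,1,\mathrm i\sqrt2),\\ v_3&=(1,-\mathrm i,q-\mathrm ip),& v_7&=(1,-\mathrm i,-q+\mathrm ip), \end{align*} \begin{align*} v_{01}&=(-p+\mathrm i(q+\sqrt2),\ \sqrt2-p+\mathrm iq,\ 1-\mathrm i),\\ v_{12}&=(\sqrt2-p+\mathrm iq,\ p-\mathrm i(q+\sqrt2),\ 1+\mathrm i),\\ v_{23}&=(q+\sqrt2+\mathrm ip,\ -q+\mathrm i(\sqrt2-p),\ -1+\mathrm i),\\ v_{34}&=(q+\mathrm i(p-\sqrt2),\ q+\sqrt2+\mathrm ip,\ -1-\mathrm i),\\ v_{45}&=(p-\mathrm i(q+\sqrt2),\ -\sqrt2+p-\mathrm iq,\ 1-\mathrm i),\\ v_{56}&=(-\sqrt2+p-\mathrm iq,\ -p+\mathrm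 i(q+\sqrt2),\ 1+\mathrm i),\\ v_{67}&=(-q-\sqrt2-\mathrm ip,\ q-\mathrm i(\sqrt2-p),\ -1+\mathrm i),\\ v_{70}&=(-q-\mathrm i(p-\sqrt2),\ -q-\sqrt2-\mathrm ip,\ -1-\mathrm i). \end{align*} Then this assignment is a faithful orthogonal representation of $\mathsf H_{21}$ in $\mathbb C^3$.
   Context: Inner product: $\langle x,y\rangle=\sum_{k}\overline{x_k}\,y_k$. Faithful orthogonal representation: let $\mathsf H=(V,\mathcal E)$ be a three-uniform hypergraph, $\mathbb F\in\{\mathbb R,\mathbb C\}$ and $d\ge 3$. A faithful orthogonal representation of $\mathsf H$ in $\mathbb F^d$ assigns to every $v\in V$ a nonzero vector $x_v\in\mathbb F^d$ such that (1) distinct vertices determine distinct rays (one-dimensional subspaces), and (2) for distinct $u,v\in V$, $\langle x_u,x_v\rangle=0$ if and only if $u$ and $v$ belong to a common hyperedge. The hypergraph $\mathsf H_{21}$: it has 21 vertices, namely $v_0,\ldots,v_7$ (midpoints), $v_{01},v_{12},v_{23},v_{34},v_{45},v_{56},v_{67},v_{70}$ (corners; also written $v_{j,j+1}$ with indices modulo $8$), $a_1,a_2,b_1,b_2$, and $c$. It has 14 hyperedges: $E_j=\{v_{j-1,j},\,v_j,\,v_{j,j+1}\}$ for $j=0,\ldots,7$ (indices modulo $8$); $D_0=\{v_0,a_1,v_4\}$, $D_2=\{v_2,a_2,v_6\}$, $D_1=\{v_1,b_2,v_5\}$, $D_3=\{v_3,b_1,v_7\}$; $F_a=\{a_1,c,a_2\}$,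 $F_b=\{b_1,c,b_2\}$. -}

module Defs where

open import Data.Integer.Base using (+_)
open import Data.List.Base using (List; _∷_; [])
import Data.List.Membership.Propositional as List
open import Data.List.Relation.Unary.All using (All; _∷_; [])
open import Data.Nat.Base as ℕ using (ℕ; zero; suc)
open import Data.Product.Base using (∃-syntax; _×_; _,_)
open import Data.Rational.Base using (_/_)
open import Data.Vec.Base using (Vec; _∷_; [])
open import Data.Vec.Functional as Vector using (Vector; foldr; zipWith)
import Data.Vec.Membership.Propositional as Vec
open import Data.Vec.Relation.Unary.All using (_∷_; [])
open import Data.Vec.Relation.Unary.AllPairs using (_∷_; [])
open import Data.Vec.Relation.Unary.Unique.Propositional using (Unique)
open import Function.Bundles using (_⇔_)
open import Level using (0ℓ)
open import Relation.Binary.PropositionalEquality using (_≡_; _≢_)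
open import Relation.Nullary using (¬_)
open import Relation.Unary using (Pred; _≐_)

-- Real numbers are Cauchy sequences of rationals, not quotiented: equality
-- of reals is _≈ℝ_ (the difference tends to zero), not _≡_.

module Real where

  open import Data.Integer.Base as ℤ using (+_)
  import Data.Integer.Properties as ℤ
  import Data.Nat.Properties as ℕ
  open import Data.Rational.Base
  open import Data.Rational.Properties
  import Data.Rational.Solver as Solver
  open import Data.Rational.Unnormalised.Base as ℚᵘ using (mkℚᵘ; *≡*; *≤*; *<*)
  import Data.Rational.Unnormalised.Properties as ℚᵘ
  open import Data.Sum.Base using (inj₁; inj₂)
  open import Relation.Binary.PropositionalEquality
    using (refl; sym; trans; cong; cong₂; subst; subst₂)
  open import Relation.Nullary using (yes; no; contradiction)
  open Solver.+-*-Solver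

  Eventually : Pred ℕ 0ℓ → Set
  Eventually P = ∃[ N ] ∀ n → N ℕ.≤ n → P n

  IsCauchy : (ℕ → ℚ) → Set
  IsCauchy s = ∀ ε → 0ℚ < ε →
    ∃[ N ] ∀ m n → N ℕ.≤ m → N ℕ.≤ n → ∣ s m - s n ∣ < ε

  record ℝ : Set where
    constructor mkℝ
    field
      seq    : ℕ → ℚ
      cauchy : IsCauchy seq

  open ℝ

  infix 4 _≈ℝ_ _≤ℝ_

  record _≈ℝ_ (x y : ℝ) : Set where
    constructor mk≈
    field
      close : ∀ ε → 0ℚ < ε → Eventually λ n → ∣ seq x n - seq y n ∣ < ε

  record _≤ℝ_ (x y : ℝ) : Set where
    constructor mk≤
    field
      below : ∀ ε → 0ℚ < ε → Eventually λ n → seq x n < seq y n + ε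

  0<1 : 0ℚ < 1ℚ
  0<1 = positive⁻¹ 1ℚ

  *-pos : ∀ {p q} → 0ℚ < p → 0ℚ < q → 0ℚ < p * q
  *-pos {p} {q} 0<p 0<q =
    positive⁻¹ (p * q) {{pos*pos⇒pos p {{positive 0<p}} q {{positive 0<q}}}}

  +-pos : ∀ {p q} → 0ℚ ≤ p → 0ℚ < q → 0ℚ < p + q
  +-pos 0≤p 0<q = +-mono-≤-< 0≤p 0<q

  half : ∀ {ε} → 0ℚ < ε → 0ℚ < ½ * ε
  half = *-pos (positive⁻¹ ½)

  halves : ∀ ε → ½ * ε + ½ * ε ≡ ε
  halves ε = trans (sym (*-distribʳ-+ ε ½ ½)) (*-identityˡ ε)

  divide : ∀ {B ε} → 0ℚ < B → 0ℚ < ε → ∃[ δ ] 0ℚ < δ × B * δ ≡ ε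
  divide {B} {ε} 0<B 0<ε = B⁻¹ * ε , *-pos 0<B⁻¹ 0<ε ,
    trans (sym (*-assoc B B⁻¹ ε))
      (trans (cong (_* ε) (*-inverseʳ B {{B≢0}})) (*-identityˡ ε))
    where
    B>0 = positive 0<B
    B≢0 = pos⇒nonZero B {{B>0}}
    B⁻¹ = (1/ B) {{B≢0}}
    0<B⁻¹ = positive⁻¹ B⁻¹ {{1/pos⇒pos B {{B>0}}}}

  *-mono : ∀ {p q r s} → 0ℚ ≤ p → 0ℚ ≤ r → p ≤ q → r ≤ s → p * r ≤ q * s
  *-mono {p} {q} {r} {s} 0≤p 0≤r p≤q r≤s = ≤-trans
    (*-monoʳ-≤-nonNeg r {{nonNegative 0≤r}} p≤q)
    (*-monoˡ-≤-nonNeg q {{nonNegative (≤-trans 0≤p p≤q)}} r≤s)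

  <-bound : ∀ {p q r s} → 0ℚ < s → ∣ p ∣ ≤ s → ∣ q ∣ < r → ∣ p * q ∣ < s * r
  <-bound {p} {q} {r} {s} 0<s p≤s q<r = ≤-<-trans
    (≤-reflexive (∣p*q∣≡∣p∣*∣q∣ p q))
    (≤-<-trans (*-monoʳ-≤-nonNeg ∣ q ∣ {{nonNegative (0≤∣p∣ q)}} p≤s)
               (*-monoʳ-<-pos s {{positive 0<s}} q<r))

  ∣∣-+-< : ∀ {p q ε} → ∣ p ∣ < ½ * ε → ∣ q ∣ < ½ * ε → ∣ p + q ∣ < ε
  ∣∣-+-< {p} {q} {ε} p< q< = ≤-<-trans (∣p+q∣≤∣p∣+∣q∣ p q)
    (subst (∣ p ∣ + ∣ q ∣ <_) (halves ε) (+-mono-< p< q<))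

  ∣∣-< : ∀ {p q ε} → p < q + ε → q < p + ε → ∣ p - q ∣ < ε
  ∣∣-< {p} {q} {ε} p< q< with ∣p∣≡p∨∣p∣≡-p (p - q)
  ... | inj₁ eq = subst (_< ε) (sym eq)
    (subst (p - q <_) (solve 2 (λ q ε → (q :+ ε) :- q := ε) refl q ε)
      (+-monoˡ-< (- q) p<))
  ... | inj₂ eq = subst (_< ε)
    (trans (solve 2 (λ p q → q :- p := :- (p :- q)) refl p q) (sym eq))
    (subst (q - p <_) (solve 2 (λ p ε → (p :+ ε) :- p := ε) refl p ε)
      (+-monoˡ-< (- p) q<))

  *-difference : ∀ a b a′ b′ → a * (b - b′) + b′ * (a - a′) ≡ a * b - a′ * b′
  *-difference = solve 4
    (λ a b a′ b′ → a :* (b :- b′) :+ b′ :* (a :- a′) := a :* b :- a′ :* b′) refl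

  *-close : ∀ {a b a′ b′ B C δ η ε} → 0ℚ < B → 0ℚ < C →
            B * δ ≡ ½ * ε → C * η ≡ ½ * ε → ∣ a ∣ ≤ B → ∣ b′ ∣ ≤ C →
            ∣ b - b′ ∣ < δ → ∣ a - a′ ∣ < η → ∣ a * b - a′ * b′ ∣ < ε
  *-close {a} {b} {a′} {b′} {ε = ε} 0<B 0<C Bδ Cη a≤B b′≤C b-b′<δ a-a′<η =
    subst (λ z → ∣ z ∣ < ε) (*-difference a b a′ b′)
      (∣∣-+-< {a * (b - b′)} {b′ * (a - a′)}
        (subst (∣ a * (b - b′) ∣ <_) Bδ (<-bound {a} {b - b′} 0<B a≤B b-b′<δ))
        (subst (∣ b′ * (a - a′) ∣ <_) Cη (<-bound {b′} {a - a′} 0<C b′≤C a-a′<η)))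

  bounded : ∀ s → IsCauchy s → ∃[ B ] 0ℚ < B × Eventually λ n → ∣ s n ∣ ≤ B
  bounded s c with N , close ← c 1ℚ 0<1 =
    ∣ s N ∣ + 1ℚ , +-pos (0≤∣p∣ (s N)) 0<1 , N , λ n N≤n →
      ≤-trans
        (≤-trans
          (≤-reflexive (cong ∣_∣ (solve 2 (λ a b → a := b :+ (a :- b)) refl (s n) (s N))))
          (∣p+q∣≤∣p∣+∣q∣ (s N) (s n - s N)))
        (+-monoʳ-≤ ∣ s N ∣ (<⇒≤ (close n N N≤n ℕ.≤-refl)))

  abstract
    const-cauchy : ∀ q → IsCauchy (λ _ → q)
    const-cauchy q ε 0<ε = 0 , λ _ _ _ _ →
      subst (_< ε) (sym (cong ∣_∣ (+-inverseʳ q))) 0<ε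

    +-cauchy : ∀ s t → IsCauchy s → IsCauchy t → IsCauchy (λ n → s n + t n)
    +-cauchy s t cs ct ε 0<ε
      with M , closeₛ ← cs (½ * ε) (half 0<ε)
         | N , closeₜ ← ct (½ * ε) (half 0<ε) =
      M ℕ.⊔ N , λ m n ≤m ≤n → subst (λ z → ∣ z ∣ < ε)
        (solve 4 (λ a b a′ b′ → (a :- a′) :+ (b :- b′) := (a :+ b) :- (a′ :+ b′)) refl
          (s m) (t m) (s n) (t n))
        (∣∣-+-<
          (closeₛ m n (ℕ.m⊔n≤o⇒m≤o M N ≤m) (ℕ.m⊔n≤o⇒m≤o M N ≤n))
          (closeₜ m n (ℕ.m⊔n≤o⇒n≤o M N ≤m) (ℕ.m⊔n≤o⇒n≤o M N ≤n)))

    neg-cauchy : ∀ s → IsCauchy s → IsCauchy (λ n → - s n)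
    neg-cauchy s c ε 0<ε with N , close ← c ε 0<ε =
      N , λ m n ≤m ≤n → subst (_< ε)
        (cong ∣_∣ (solve 2 (λ a b → b :- a := (:- a) :- (:- b)) refl (s m) (s n)))
        (close n m ≤n ≤m)

    *-cauchy : ∀ s t → IsCauchy s → IsCauchy t → IsCauchy (λ n → s n * t n)
    *-cauchy s t cs ct ε 0<ε =
      let B , 0<B , Nₛ , s≤B = bounded s cs
          C , 0<C , Nₜ , t≤C = bounded t ct
          δ , 0<δ , Bδ = divide 0<B (half 0<ε)
          η , 0<η , Cη = divide 0<C (half 0<ε)
          M , closeₜ = ct δ 0<δ
          N , closeₛ = cs η 0<η
      in (Nₛ ℕ.⊔ Nₜ) ℕ.⊔ (M ℕ.⊔ N) , λ m n ≤m ≤n →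
        let ≤m₁ = ℕ.m⊔n≤o⇒m≤o (Nₛ ℕ.⊔ Nₜ) (M ℕ.⊔ N) ≤m
            ≤m₂ = ℕ.m⊔n≤o⇒n≤o (Nₛ ℕ.⊔ Nₜ) (M ℕ.⊔ N) ≤m
            ≤n₁ = ℕ.m⊔n≤o⇒m≤o (Nₛ ℕ.⊔ Nₜ) (M ℕ.⊔ N) ≤n
            ≤n₂ = ℕ.m⊔n≤o⇒n≤o (Nₛ ℕ.⊔ Nₜ) (M ℕ.⊔ N) ≤n
        in *-close {s m} {t m} {s n} {t n} {B} {C} {δ} {η} {ε} 0<B 0<C Bδ Cη
          (s≤B m (ℕ.m⊔n≤o⇒m≤o Nₛ Nₜ ≤m₁))
          (t≤C n (ℕ.m⊔n≤o⇒n≤o Nₛ Nₜ ≤n₁))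
          (closeₜ m n (ℕ.m⊔n≤o⇒m≤o M N ≤m₂) (ℕ.m⊔n≤o⇒m≤o M N ≤n₂))
          (closeₛ m n (ℕ.m⊔n≤o⇒n≤o M N ≤m₂) (ℕ.m⊔n≤o⇒n≤o M N ≤n₂))

  infix  8 -ℝ_
  infixl 7 _*ℝ_
  infixl 6 _+ℝ_ _-ℝ_

  fromℚ : ℚ → ℝ
  fromℚ q = mkℝ (λ _ → q) (const-cauchy q)

  -ℝ_ : ℝ → ℝ
  -ℝ x = mkℝ (λ n → - seq x n) (neg-cauchy (seq x) (cauchy x))

  _+ℝ_ _*ℝ_ _-ℝ_ : ℝ → ℝ → ℝ
  x +ℝ y = mkℝ (λ n → seq x n + seq y n) (+-cauchy (seq x) (seq y) (cauchy x) (cauchy y))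
  x *ℝ y = mkℝ (λ n → seq x n * seq y n) (*-cauchy (seq x) (seq y) (cauchy x) (cauchy y))
  x -ℝ y = x +ℝ (-ℝ y)

  0ℝ 1ℝ : ℝ
  0ℝ = fromℚ 0ℚ
  1ℝ = fromℚ 1ℚ

  -- isqrt n is the integer part of √n, so √-seq n k is the largest multiple
  -- of 1/(k+1) that is at most √n; √-nonNegative and √-square characterise √.
  isqrt : ℕ → ℕ
  isqrt zero    = 0
  isqrt (suc n) with suc (isqrt n) ℕ.* suc (isqrt n) ℕ.≤? suc n
  ... | yes _ = suc (isqrt n)
  ... | no  _ = isqrt n

  √-seq : ℕ → ℕ → ℚ
  √-seq n k = + isqrt (n ℕ.* (suc k ℕ.* suc k)) / suc k

  isqrt-≤ : ∀ n → isqrt n ℕ.* isqrt n ℕ.≤ n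
  isqrt-≤ zero    = ℕ.z≤n
  isqrt-≤ (suc n) with suc (isqrt n) ℕ.* suc (isqrt n) ℕ.≤? suc n
  ... | yes ≤n = ≤n
  ... | no  _  = ℕ.m≤n⇒m≤1+n (isqrt-≤ n)

  isqrt-> : ∀ n → n ℕ.< suc (isqrt n) ℕ.* suc (isqrt n)
  isqrt-> zero    = ℕ.s≤s ℕ.z≤n
  isqrt-> (suc n) with suc (isqrt n) ℕ.* suc (isqrt n) ℕ.≤? suc n
  ... | yes _  = ℕ.≤-<-trans (isqrt-> n)
                   (ℕ.*-mono-< (ℕ.n<1+n (suc (isqrt n))) (ℕ.n<1+n (suc (isqrt n))))
  ... | no  ≰n = ℕ.≰⇒> ≰n

  frac : ℕ → ℕ → ℚ
  frac m k = + m / suc k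

  toℚᵘ-frac : ∀ m k → toℚᵘ (frac m k) ℚᵘ.≃ mkℚᵘ (+ m) k
  toℚᵘ-frac m k = toℚᵘ-fromℚᵘ (mkℚᵘ (+ m) k)

  frac-≤ : ∀ {m k m′ k′} → m ℕ.* suc k′ ℕ.≤ m′ ℕ.* suc k → frac m k ≤ frac m′ k′
  frac-≤ {m} {k} {m′} {k′} ≤′ = toℚᵘ-cancel-≤
    (ℚᵘ.≤-respˡ-≃ (ℚᵘ.≃-sym (toℚᵘ-frac m k))
      (ℚᵘ.≤-respʳ-≃ (ℚᵘ.≃-sym (toℚᵘ-frac m′ k′))
        (*≤* (subst₂ ℤ._≤_ (ℤ.pos-* m (suc k′)) (ℤ.pos-* m′ (suc k)) (ℤ.+≤+ ≤′)))))

  frac-< : ∀ {m k m′ k′} → m ℕ.* suc k′ ℕ.< m′ ℕ.* suc k → frac m k < frac m′ k′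
  frac-< {m} {k} {m′} {k′} <′ = toℚᵘ-cancel-<
    (ℚᵘ.<-respˡ-≃ (ℚᵘ.≃-sym (toℚᵘ-frac m k))
      (ℚᵘ.<-respʳ-≃ (ℚᵘ.≃-sym (toℚᵘ-frac m′ k′))
        (*<* (subst₂ ℤ._<_ (ℤ.pos-* m (suc k′)) (ℤ.pos-* m′ (suc k)) (ℤ.+<+ <′)))))

  frac-* : ∀ m k m′ k′ →
           frac m k * frac m′ k′ ≡ frac (m ℕ.* m′) (k′ ℕ.+ k ℕ.* suc k′)
  frac-* m k m′ k′ = toℚᵘ-injective
    (ℚᵘ.≃-trans (toℚᵘ-homo-* (frac m k) (frac m′ k′))
    (ℚᵘ.≃-trans (ℚᵘ.*-cong (toℚᵘ-frac m k) (toℚᵘ-frac m′ k′))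
    (ℚᵘ.≃-trans (ℚᵘ.≃-reflexive (cong (λ z → mkℚᵘ z _) (sym (ℤ.pos-* m m′))))
                (ℚᵘ.≃-sym (toℚᵘ-frac _ _)))))

  frac-+1 : ∀ m k → frac m k + frac 1 k ≡ frac (suc m) k
  frac-+1 m k = toℚᵘ-injective
    (ℚᵘ.≃-trans (toℚᵘ-homo-+ (frac m k) (frac 1 k))
    (ℚᵘ.≃-trans (ℚᵘ.+-cong (toℚᵘ-frac m k) (toℚᵘ-frac 1 k))
    (ℚᵘ.≃-trans (*≡* eq) (ℚᵘ.≃-sym (toℚᵘ-frac (suc m) k)))))
    where
    num : + m ℤ.* + suc k ℤ.+ + 1 ℤ.* + suc k ≡ + (suc m ℕ.* suc k)
    num = trans (sym (ℤ.*-distribʳ-+ (+ suc k) (+ m) (+ 1)))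
            (trans (sym (ℤ.pos-* (m ℕ.+ 1) (suc k)))
              (cong (λ z → + (z ℕ.* suc k)) (ℕ.+-comm m 1)))
    eq : (+ m ℤ.* + suc k ℤ.+ + 1 ℤ.* + suc k) ℤ.* + suc k
         ≡ + suc m ℤ.* + (suc k ℕ.* suc k)
    eq = trans (cong (ℤ._* + suc k) num)
      (trans (cong (ℤ._* + suc k) (ℤ.pos-* (suc m) (suc k)))
      (trans (ℤ.*-assoc (+ suc m) (+ suc k) (+ suc k))
             (cong (+ suc m ℤ.*_) (sym (ℤ.pos-* (suc k) (suc k))))))

  u : ℕ → ℚ
  u = frac 1

  0<u : ∀ k → 0ℚ < u k
  0<u k = frac-< {0} {0} {1} {k} (ℕ.s≤s ℕ.z≤n)

  u-small : ∀ ε → 0ℚ < ε → Eventually λ k → u k ≤ ε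
  u-small ε@(mkℚ (+ 0) _ _)       0<ε = contradiction 0<ε (λ { (*<* (ℤ.+<+ ())) })
  u-small ε@(mkℚ (ℤ.-[1+ _ ]) _ _) 0<ε = contradiction 0<ε (λ { (*<* ()) })
  u-small ε@(mkℚ (+ suc a) d _)   0<ε = d , λ k d≤k →
    subst (u k ≤_) (fromℚᵘ-toℚᵘ ε)
      (frac-≤ {1} {k} {suc a} {d}
        (ℕ.*-mono-≤ {1} {suc a} (ℕ.s≤s ℕ.z≤n) (ℕ.s≤s d≤k)))

  module _ (n : ℕ) where

    r : ℕ → ℕ
    r k = isqrt (n ℕ.* (suc k ℕ.* suc k))

    0≤√ : ∀ k → 0ℚ ≤ √-seq n k
    0≤√ k = frac-≤ {0} {0} {r k} {k} ℕ.z≤n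

    √²≤ : ∀ k → √-seq n k * √-seq n k ≤ frac n 0
    √²≤ k = subst (_≤ frac n 0) (sym (frac-* (r k) k (r k) k))
      (frac-≤ {r k ℕ.* r k} {_} {n} {0}
        (subst (ℕ._≤ n ℕ.* (suc k ℕ.* suc k)) (sym (ℕ.*-identityʳ _))
          (isqrt-≤ (n ℕ.* (suc k ℕ.* suc k)))))

    <√² : ∀ k → frac n 0 < (√-seq n k + u k) * (√-seq n k + u k)
    <√² k = subst (frac n 0 <_)
      (sym (trans (cong (λ z → z * z) (frac-+1 (r k) k))
                  (frac-* (suc (r k)) k (suc (r k)) k)))
      (frac-< {n} {0} {suc (r k) ℕ.* suc (r k)}
        (subst (n ℕ.* (suc k ℕ.* suc k) ℕ.<_) (sym (ℕ.*-identityʳ _))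
          (isqrt-> (n ℕ.* (suc k ℕ.* suc k)))))

    square-cancel : ∀ {x y} → 0ℚ ≤ y → x * x ≤ frac n 0 → frac n 0 < y * y → x < y
    square-cancel {x} {y} 0≤y x²≤n n<y² with x <? y
    ... | yes x<y = x<y
    ... | no  x≮y = contradiction
      (<-≤-trans n<y² (≤-trans (*-mono 0≤y 0≤y y≤x y≤x) x²≤n)) (<-irrefl refl)
      where y≤x = ≮⇒≥ x≮y

    √-close : ∀ k l → √-seq n k < √-seq n l + u l
    √-close k l = square-cancel (<⇒≤ (+-pos (0≤√ l) (0<u l))) (√²≤ k) (<√² l)

  abstract
    √-cauchy : ∀ n → IsCauchy (√-seq n)
    √-cauchy n ε 0<ε with N , small ← u-small ε 0<ε =
      N , λ k l N≤k N≤l → ∣∣-<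
        (<-≤-trans (√-close n k l) (+-monoʳ-≤ (√-seq n l) (small l N≤l)))
        (<-≤-trans (√-close n l k) (+-monoʳ-≤ (√-seq n k) (small k N≤k)))

  √_ : ℕ → ℝ
  √ n = mkℝ (√-seq n) (√-cauchy n)

  abstract
    √-nonNegative : ∀ n → 0ℝ ≤ℝ √ n
    √-nonNegative n = mk≤ λ ε 0<ε → 0 , λ k _ → +-pos (0≤√ n k) 0<ε

    √-square : ∀ n → √ n *ℝ √ n ≈ℝ fromℚ (+ n / 1)
    √-square n = mk≈ λ ε 0<ε →
      let B , 0<B , M , √≤B = bounded (√-seq n) (√-cauchy n)
          δ , 0<δ , Cδ = divide (+-pos (<⇒≤ (+-pos (<⇒≤ 0<B) 0<B)) 0<1) 0<ε
          N , small = u-small δ 0<δ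
      in M ℕ.⊔ N , λ k ≤k →
        let a   = √-seq n k
            a≤B = ≤-trans (≤-reflexive (sym (0≤p⇒∣p∣≡p (0≤√ n k))))
                          (√≤B k (ℕ.m⊔n≤o⇒m≤o M N ≤k))
            u≤1 = frac-≤ {1} {k} {1} {0} (ℕ.s≤s ℕ.z≤n)
            error≤ε : (a + a + u k) * u k ≤ ε
            error≤ε = subst ((a + a + u k) * u k ≤_) Cδ
              (*-mono (<⇒≤ (+-pos (+-mono-≤ (0≤√ n k) (0≤√ n k)) (0<u k))) (<⇒≤ (0<u k))
                (+-mono-≤ (+-mono-≤ a≤B a≤B) u≤1)
                (small k (ℕ.m⊔n≤o⇒n≤o M N ≤k)))
        in ∣∣-<
          (≤-<-trans (√²≤ n k)
            (subst (_< frac n 0 + ε) (+-identityʳ (frac n 0)) (+-monoʳ-< (frac n 0) 0<ε)))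
          (<-≤-trans (<√² n k)
            (subst (_≤ a * a + ε)
              (solve 2 (λ a u → a :* a :+ (a :+ a :+ u) :* u := (a :+ u) :* (a :+ u))
                refl a (u k))
              (+-monoʳ-≤ (a * a) error≤ε)))

open Real public using (ℝ; _≈ℝ_; _+ℝ_; _*ℝ_; -ℝ_; _-ℝ_; 0ℝ; 1ℝ; fromℚ; √_)

record ℂ : Set where
  constructor _+i_
  field
    re im : ℝ

open ℂ public

infix  4 _≈_
infix  8 -_
infixl 7 _*_
infixl 6 _+_ _-_

_≈_ : ℂ → ℂ → Set
z ≈ w = re z ≈ℝ re w × im z ≈ℝ im w

-_ conj : ℂ → ℂ
- z    = (-ℝ re z) +i (-ℝ im z)
conj z = re z +i (-ℝ im z)

_+_ _*_ _-_ : ℂ → ℂ → ℂ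
z + w = (re z +ℝ re w) +i (im z +ℝ im w)
z * w = (re z *ℝ re w -ℝ im z *ℝ im w) +i (re z *ℝ im w +ℝ im z *ℝ re w)
z - w = z + (- w)

fromℝ : ℝ → ℂ
fromℝ x = x +i 0ℝ

0ℂ 1ℂ 𝕚 : ℂ
0ℂ = fromℝ 0ℝ
1ℂ = fromℝ 1ℝ
𝕚  = 0ℝ +i 1ℝ

infix 4 _≈ᵛ_

_≈ᵛ_ : ∀ {d} → Vector ℂ d → Vector ℂ d → Set
x ≈ᵛ y = ∀ k → x k ≈ y k

0ᵛ : ∀ {d} → Vector ℂ d
0ᵛ _ = 0ℂ

_·_ : ∀ {d} → ℂ → Vector ℂ d → Vector ℂ d
(z · x) k = z * x k

⟨_,_⟩ : ∀ {d} → Vector ℂ d → Vector ℂ d → ℂ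
⟨ x , y ⟩ = foldr _+_ 0ℂ (zipWith (λ xₖ yₖ → conj xₖ * yₖ) x y)

-- The subspace spanned by x, as a set of vectors.
ray : ∀ {d} → Vector ℂ d → Pred (Vector ℂ d) 0ℓ
ray x y = ∃[ z ] y ≈ᵛ z · x

record ThreeUniformHypergraph : Set₁ where
  -- Each hyperedge is listed as its three distinct vertices; their order,
  -- and that of the list, plays no role.
  field
    Vertex     : Set
    hyperedges : List (Vec Vertex 3)
    unique     : All Unique hyperedges

  ShareHyperedge : Vertex → Vertex → Set
  ShareHyperedge u v = ∃[ e ] e List.∈ hyperedges × u Vec.∈ e × v Vec.∈ e

record IsFaithfulOrthogonalRepresentation
  (H : ThreeUniformHypergraph) {d : ℕ} (3≤d : 3 ℕ.≤ d)
  (x : ThreeUniformHypergraph.Vertex H → Vector ℂ d) : Set where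
  open ThreeUniformHypergraph H
  field
    nonzero       : ∀ v → ¬ (x v ≈ᵛ 0ᵛ)
    distinct-rays : ∀ {u v} → u ≢ v → ¬ (ray (x u) ≐ ray (x v))
    orthogonality : ∀ {u v} → u ≢ v → ⟨ x u , x v ⟩ ≈ 0ℂ ⇔ ShareHyperedge u v

data V₂₁ : Set where
  v₀ v₁ v₂ v₃ v₄ v₅ v₆ v₇                 : V₂₁
  v₀₁ v₁₂ v₂₃ v₃₄ v₄₅ v₅₆ v₆₇ v₇₀         : V₂₁
  a₁ a₂ b₁ b₂ c                           : V₂₁

private
  unique₃ : ∀ {A : Set} {x y z : A} → x ≢ y → x ≢ z → y ≢ z →
            Unique (x ∷ y ∷ z ∷ [])
  unique₃ x≢y x≢z y≢z = (x≢y ∷ x≢z ∷ []) ∷ (y≢z ∷ []) ∷ [] ∷ []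

H₂₁ : ThreeUniformHypergraph
H₂₁ = record
  { Vertex     = V₂₁
  ; hyperedges =
        edge v₇₀ v₀ v₀₁
      ∷ edge v₀₁ v₁ v₁₂
      ∷ edge v₁₂ v₂ v₂₃
      ∷ edge v₂₃ v₃ v₃₄
      ∷ edge v₃₄ v₄ v₄₅
      ∷ edge v₄₅ v₅ v₅₆
      ∷ edge v₅₆ v₆ v₆₇
      ∷ edge v₆₇ v₇ v₇₀
      ∷ edge v₀ a₁ v₄
      ∷ edge v₂ a₂ v₆
      ∷ edge v₁ b₂ v₅
      ∷ edge v₃ b₁ v₇
      ∷ edge a₁ c a₂
      ∷ edge b₁ c b₂
      ∷ []
  ; unique     =
        unique₃ (λ ()) (λ ()) (λ ())
      ∷ unique₃ (λ ()) (λ ()) (λ ())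
      ∷ unique₃ (λ ()) (λ ()) (λ ())
      ∷ unique₃ (λ ()) (λ ()) (λ ())
      ∷ unique₃ (λ ()) (λ ()) (λ ())
      ∷ unique₃ (λ ()) (λ ()) (λ ())
      ∷ unique₃ (λ ()) (λ ()) (λ ())
      ∷ unique₃ (λ ()) (λ ()) (λ ())
      ∷ unique₃ (λ ()) (λ ()) (λ ())
      ∷ unique₃ (λ ()) (λ ()) (λ ())
      ∷ unique₃ (λ ()) (λ ()) (λ ())
      ∷ unique₃ (λ ()) (λ ()) (λ ())
      ∷ unique₃ (λ ()) (λ ()) (λ ())
      ∷ unique₃ (λ ()) (λ ()) (λ ())
      ∷ []
  }
  where
  edge : V₂₁ → V₂₁ → V₂₁ → Vec V₂₁ 3
  edge x y z = x ∷ y ∷ z ∷ []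

√2 p q : ℂ
√2 = fromℝ (√ 2)
p  = fromℝ ((√ 14 +ℝ √ 2) *ℝ fromℚ (+ 1 / 4))
q  = fromℝ ((√ 14 -ℝ √ 2) *ℝ fromℚ (+ 1 / 4))

[_,_,_] : ℂ → ℂ → ℂ → Vector ℂ 3
[ x , y , z ] = x Vector.∷ y Vector.∷ z Vector.∷ Vector.[]

vector : V₂₁ → Vector ℂ 3
vector c   = [ 0ℂ , 0ℂ , 1ℂ ]
vector a₁  = [ 1ℂ , 1ℂ , 0ℂ ]
vector a₂  = [ 1ℂ , - 1ℂ , 0ℂ ]
vector b₁  = [ 1ℂ , 𝕚 , 0ℂ ]
vector b₂  = [ 1ℂ , - 𝕚 , 0ℂ ]
vector v₀  = [ 1ℂ , - 1ℂ , √2 ]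
vector v₄  = [ 1ℂ , - 1ℂ , - √2 ]
vector v₁  = [ 1ℂ , 𝕚 , p + 𝕚 * q ]
vector v₅  = [ 1ℂ , 𝕚 , - p - 𝕚 * q ]
vector v₂  = [ 1ℂ , 1ℂ , - 𝕚 * √2 ]
vector v₆  = [ 1ℂ , 1ℂ , 𝕚 * √2 ]
vector v₃  = [ 1ℂ , - 𝕚 , q - 𝕚 * p ]
vector v₇  = [ 1ℂ , - 𝕚 , - q + 𝕚 * p ]
vector v₀₁ = [ - p + 𝕚 * (q + √2) , √2 - p + 𝕚 * q , 1ℂ - 𝕚 ]
vector v₁₂ = [ √2 - p + 𝕚 * q , p - 𝕚 * (q + √2) , 1ℂ + 𝕚 ]
vector v₂₃ = [ q + √2 + 𝕚 * p , - q + 𝕚 * (√2 - p) , - 1ℂ + 𝕚 ]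
vector v₃₄ = [ q + 𝕚 * (p - √2) , q + √2 + 𝕚 * p , - 1ℂ - 𝕚 ]
vector v₄₅ = [ p - 𝕚 * (q + √2) , - √2 + p - 𝕚 * q , 1ℂ - 𝕚 ]
vector v₅₆ = [ - √2 + p - 𝕚 * q , - p + 𝕚 * (q + √2) , 1ℂ + 𝕚 ]
vector v₆₇ = [ - q - √2 - 𝕚 * p , q - 𝕚 * (√2 - p) , - 1ℂ + 𝕚 ]
vector v₇₀ = [ - q - 𝕚 * (p - √2) , - q - √2 - 𝕚 * p , - 1ℂ - 𝕚 ]

{-# OPTIONS --safe #-}

-- All coordinates lie in ℚ(√2, √14, i), where equality with zero is decided by
-- rational arithmetic: a + b√n is nonzero if its norm a² − n b² is, and a + bi
-- if a or b is. Inner products are tested this way; two vectors span different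
-- rays as soon as one of their 2 × 2 minors passes the test. There are finitely
-- many pairs of vertices, so the whole claim is settled by computation.
module Submission where

open import Defs
open import Data.Nat.Properties using (≤-refl)

open import Algebra.Bundles using (CommutativeRing)
open import Algebra.Solver.Ring.AlmostCommutativeRing
  using (fromCommutativeRing; Induced-equivalence; _-Raw-AlmostCommutative⟶_)
import Algebra.Solver.Ring as RingSolver
open import Data.Fin.Base using (zero; suc)
open import Data.Fin using (#_)
open import Data.Fin.Properties using (all?; any?) renaming (_≟_ to _≟ᶠ_)
open import Data.Integer.Base using (+_)
import Data.List.Membership.Propositional as List
import Data.List.Relation.Unary.Any as Any
import Data.Maybe.Base as Maybe
import Data.Nat.Base as ℕ
import Data.Nat.Properties as ℕ
open import Data.Product.Base using (∃-syntax; _×_; _,_; proj₁; proj₂)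
open import Data.Rational.Base as ℚ using (ℚ; 0ℚ; 1ℚ)
import Data.Rational.Properties as ℚ
open import Data.Sum.Base using (_⊎_; inj₁; inj₂; [_,_]′)
open import Data.Vec.Base using (Vec; _∷_; []; lookup)
open import Data.Vec.Functional as Vector using (Vector)
import Data.Vec.Membership.DecPropositional as DecMembership
open import Function.Base using (_∘_)
open import Function.Bundles using (_⇔_; mk⇔)
open import Level using (0ℓ)
open import Relation.Binary.Definitions using (DecidableEquality; WeaklyDecidable)
open import Relation.Binary.PropositionalEquality as ≡ using (_≡_; _≢_; refl)
import Relation.Binary.Reasoning.Setoid as SetoidReasoning
open import Relation.Binary.Structures using (IsEquivalence)
open import Relation.Nullary using (¬_; Dec; contradiction)
open import Relation.Nullary.Decidable
  using (map′; ¬?; _×-dec_; _⊎-dec_; dec⇒maybe; from-yes)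
open import Relation.Unary using (Pred; Decidable; _≐_)

open Real using (mk≈; ∣∣-+-<; half; divide; *-close; bounded)
open Real.ℝ using (seq; cauchy)

-- The commutative ring of real numbers

-- Termwise equality makes every difference exactly zero. Ring laws of ℚ pass to ℝ this way; only
-- equivalence and congruence still call for estimates.
pointwise : ∀ {x y} → (∀ n → seq x n ≡ seq y n) → x ≈ℝ y
pointwise {x} {y} eq = mk≈ λ ε 0<ε → 0 , λ n _ →
  ≡.subst (ℚ._< ε)
    (≡.sym (≡.trans (≡.cong (λ z → ℚ.∣ z ℚ.- seq y n ∣) (eq n))
                    (≡.cong ℚ.∣_∣ (ℚ.+-inverseʳ (seq y n)))))
    0<ε

module _ where
  open import Data.Rational.Solver using (module +-*-Solver)
  open +-*-Solver

  ≈ℝ-sym : ∀ {x y} → x ≈ℝ y → y ≈ℝ x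
  ≈ℝ-sym {x} {y} (mk≈ x≈y) = mk≈ λ ε 0<ε →
    let N , close = x≈y ε 0<ε in
    N , λ n N≤n → ≡.subst (ℚ._< ε)
      (≡.trans (≡.sym (ℚ.∣-p∣≡∣p∣ (seq x n ℚ.- seq y n)))
        (≡.cong ℚ.∣_∣ (solve 2 (λ a b → :- (a :- b) := b :- a) refl (seq x n) (seq y n))))
      (close n N≤n)

  ≈ℝ-trans : ∀ {x y z} → x ≈ℝ y → y ≈ℝ z → x ≈ℝ z
  ≈ℝ-trans {x} {y} {z} (mk≈ x≈y) (mk≈ y≈z) = mk≈ λ ε 0<ε →
    let M , close₁ = x≈y (ℚ.½ ℚ.* ε) (half 0<ε)
        N , close₂ = y≈z (ℚ.½ ℚ.* ε) (half 0<ε) in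
    M ℕ.⊔ N , λ n ≤n → ≡.subst (λ w → ℚ.∣ w ∣ ℚ.< ε)
      (solve 3 (λ a b a′ → (a :- b) :+ (b :- a′) := a :- a′) refl (seq x n) (seq y n) (seq z n))
      (∣∣-+-< (close₁ n (ℕ.m⊔n≤o⇒m≤o M N ≤n)) (close₂ n (ℕ.m⊔n≤o⇒n≤o M N ≤n)))

  +ℝ-cong : ∀ {x x′ y y′} → x ≈ℝ x′ → y ≈ℝ y′ → x +ℝ y ≈ℝ x′ +ℝ y′
  +ℝ-cong {x} {x′} {y} {y′} (mk≈ x≈x′) (mk≈ y≈y′) = mk≈ λ ε 0<ε →
    let M , close₁ = x≈x′ (ℚ.½ ℚ.* ε) (half 0<ε)
        N , close₂ = y≈y′ (ℚ.½ ℚ.* ε) (half 0<ε) in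
    M ℕ.⊔ N , λ n ≤n → ≡.subst (λ w → ℚ.∣ w ∣ ℚ.< ε)
      (solve 4 (λ a a′ b b′ → (a :- a′) :+ (b :- b′) := (a :+ b) :- (a′ :+ b′)) refl
        (seq x n) (seq x′ n) (seq y n) (seq y′ n))
      (∣∣-+-< (close₁ n (ℕ.m⊔n≤o⇒m≤o M N ≤n)) (close₂ n (ℕ.m⊔n≤o⇒n≤o M N ≤n)))

  -ℝ-cong : ∀ {x y} → x ≈ℝ y → -ℝ x ≈ℝ -ℝ y
  -ℝ-cong {x} {y} (mk≈ x≈y) = mk≈ λ ε 0<ε →
    let N , close = x≈y ε 0<ε in
    N , λ n N≤n → ≡.subst (ℚ._< ε)
      (≡.trans (≡.sym (ℚ.∣-p∣≡∣p∣ (seq x n ℚ.- seq y n)))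
        (≡.cong ℚ.∣_∣ (solve 2 (λ a b → :- (a :- b) := (:- a) :- (:- b)) refl
          (seq x n) (seq y n))))
      (close n N≤n)

-- The difference of products is x (y - y′) + y′ (x - x′), and Cauchy sequences are bounded, so each
-- summand can be made smaller than ε/2.
*ℝ-cong : ∀ {x x′ y y′} → x ≈ℝ x′ → y ≈ℝ y′ → x *ℝ y ≈ℝ x′ *ℝ y′
*ℝ-cong {x} {x′} {y} {y′} (mk≈ x≈x′) (mk≈ y≈y′) = mk≈ λ ε 0<ε →
  let B , 0<B , K , x≤B  = bounded (seq x) (cauchy x)
      C , 0<C , L , y′≤C = bounded (seq y′) (cauchy y′)
      -- These tolerances satisfy B δ = C η = ε/2.
      δ , 0<δ , Bδ = divide 0<B (half 0<ε)
      η , 0<η , Cη = divide 0<C (half 0<ε)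
      M , close₁ = y≈y′ δ 0<δ
      N , close₂ = x≈x′ η 0<η
  in (K ℕ.⊔ L) ℕ.⊔ (M ℕ.⊔ N) , λ n ≤n →
    let KL≤n = ℕ.m⊔n≤o⇒m≤o (K ℕ.⊔ L) (M ℕ.⊔ N) ≤n
        MN≤n = ℕ.m⊔n≤o⇒n≤o (K ℕ.⊔ L) (M ℕ.⊔ N) ≤n
    in *-close {seq x n} {seq y n} {seq x′ n} {seq y′ n} {B} {C} {δ} {η} {ε} 0<B 0<C Bδ Cη
      (x≤B n (ℕ.m⊔n≤o⇒m≤o K L KL≤n))
      (y′≤C n (ℕ.m⊔n≤o⇒n≤o K L KL≤n))
      (close₁ n (ℕ.m⊔n≤o⇒m≤o M N MN≤n))
      (close₂ n (ℕ.m⊔n≤o⇒n≤o M N MN≤n))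

≈ℝ-isEquivalence : IsEquivalence _≈ℝ_
≈ℝ-isEquivalence = record
  { refl  = pointwise λ _ → refl
  ; sym   = ≈ℝ-sym
  ; trans = ≈ℝ-trans
  }

ℝ-commutativeRing : CommutativeRing 0ℓ 0ℓ
ℝ-commutativeRing = record
  { Carrier = ℝ
  ; _≈_ = _≈ℝ_
  ; _+_ = _+ℝ_
  ; _*_ = _*ℝ_
  ; -_  = -ℝ_
  ; 0#  = 0ℝ
  ; 1#  = 1ℝ
  ; isCommutativeRing = record
    { isRing = record
      { +-isAbelianGroup = record
        { isGroup = record
          { isMonoid = record
            { isSemigroup = record
              { isMagma = record
                { isEquivalence = ≈ℝ-isEquivalence
                ; ∙-cong        = +ℝ-cong
                }
              ; assoc = λ x y z → pointwise λ n → ℚ.+-assoc (seq x n) (seq y n) (seq z n)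
              }
            ; identity = (λ x → pointwise λ n → ℚ.+-identityˡ (seq x n))
                       , (λ x → pointwise λ n → ℚ.+-identityʳ (seq x n))
            }
          ; inverse = (λ x → pointwise λ n → ℚ.+-inverseˡ (seq x n))
                    , (λ x → pointwise λ n → ℚ.+-inverseʳ (seq x n))
          ; ⁻¹-cong = -ℝ-cong
          }
        ; comm = λ x y → pointwise λ n → ℚ.+-comm (seq x n) (seq y n)
        }
      ; *-cong     = *ℝ-cong
      ; *-assoc    = λ x y z → pointwise λ n → ℚ.*-assoc (seq x n) (seq y n) (seq z n)
      ; *-identity = (λ x → pointwise λ n → ℚ.*-identityˡ (seq x n))
                   , (λ x → pointwise λ n → ℚ.*-identityʳ (seq x n))
      ; distrib    = (λ x y z → pointwise λ n → ℚ.*-distribˡ-+ (seq x n) (seq y n) (seq z n))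
                   , (λ x y z → pointwise λ n → ℚ.*-distribʳ-+ (seq x n) (seq y n) (seq z n))
      }
    ; *-comm = λ x y → pointwise λ n → ℚ.*-comm (seq x n) (seq y n)
    }
  }

-- Polynomial identities over ℝ with rational coefficients

module ℛ = CommutativeRing ℝ-commutativeRing

fromℚ-morphism : CommutativeRing.rawRing ℚ.+-*-commutativeRing
                   -Raw-AlmostCommutative⟶ fromCommutativeRing ℝ-commutativeRing
fromℚ-morphism = record
  { ⟦_⟧    = fromℚ
  ; +-homo = λ _ _ → pointwise λ _ → refl
  ; *-homo = λ _ _ → pointwise λ _ → refl
  ; -‿homo = λ _ → pointwise λ _ → refl
  ; 0-homo = pointwise λ _ → refl
  ; 1-homo = pointwise λ _ → refl
  }

fromℚ-≟ : WeaklyDecidable (Induced-equivalence fromℚ-morphism)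
fromℚ-≟ a b = Maybe.map (λ { refl → ℛ.refl }) (dec⇒maybe (a ℚ.≟ b))

module ℝ-Solver = RingSolver
  (CommutativeRing.rawRing ℚ.+-*-commutativeRing)
  (fromCommutativeRing ℝ-commutativeRing)
  fromℚ-morphism
  fromℚ-≟

-- Taking ε = ∣a∣ would force ∣a∣ < ∣a∣. This is the base case to which the norms reduce every proof
-- that a real number is nonzero.
fromℚ-≉0 : ∀ {a} → a ≢ 0ℚ → ¬ (fromℚ a ≈ℝ 0ℝ)
fromℚ-≉0 {a} a≢0 (mk≈ close) =
  let N , near = close ℚ.∣ a ∣ 0<∣a∣ in
  ℚ.<-irrefl (≡.cong ℚ.∣_∣ (ℚ.+-identityʳ a)) (near N ℕ.≤-refl)
  where
  0<∣a∣ : 0ℚ ℚ.< ℚ.∣ a ∣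
  0<∣a∣ = ℚ.≰⇒> λ ∣a∣≤0 → a≢0 (ℚ.∣p∣≡0⇒p≡0 a (ℚ.≤-antisym ∣a∣≤0 (ℚ.0≤∣p∣ a)))

-- Exact arithmetic in multiquadratic number fields

-- Zero and NonZero are one-sided tests: they need not cover Carrier.
record RealSubring : Set₁ where
  infix  8 ⊖_
  infixl 7 _⊗_
  infixl 6 _⊕_
  field
    Carrier  : Set
    _⊕_ _⊗_  : Carrier → Carrier → Carrier
    ⊖_       : Carrier → Carrier
    rational : ℚ → Carrier
    ι        : Carrier → ℝ
    ⊕-homo   : ∀ a b → ι a +ℝ ι b ≈ℝ ι (a ⊕ b)
    ⊗-homo   : ∀ a b → ι a *ℝ ι b ≈ℝ ι (a ⊗ b)
    ⊖-homo   : ∀ a → -ℝ ι a ≈ℝ ι (⊖ a)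
    rational-homo : ∀ r → fromℚ r ≈ℝ ι (rational r)
    Zero NonZero  : Pred Carrier 0ℓ
    zero?    : Decidable Zero
    nonZero? : Decidable NonZero
    zero⇒≈0    : ∀ {a} → Zero a → ι a ≈ℝ 0ℝ
    nonZero⇒≉0 : ∀ {a} → NonZero a → ¬ (ι a ≈ℝ 0ℝ)

  -- Stated for any real `x` represented by `a`, so that representations compose along an
  -- expression.
  ι-sum : ∀ {x y a b} → x ≈ℝ ι a → y ≈ℝ ι b → x +ℝ y ≈ℝ ι (a ⊕ b)
  ι-sum {a = a} {b} x≈a y≈b = ℛ.trans (ℛ.+-cong x≈a y≈b) (⊕-homo a b)

  ι-product : ∀ {x y a b} → x ≈ℝ ι a → y ≈ℝ ι b → x *ℝ y ≈ℝ ι (a ⊗ b)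
  ι-product {a = a} {b} x≈a y≈b = ℛ.trans (ℛ.*-cong x≈a y≈b) (⊗-homo a b)

  ι-negation : ∀ {x a} → x ≈ℝ ι a → -ℝ x ≈ℝ ι (⊖ a)
  ι-negation {a = a} x≈a = ℛ.trans (ℛ.-‿cong x≈a) (⊖-homo a)

rationals : RealSubring
rationals = record
  { Carrier  = ℚ
  ; _⊕_      = ℚ._+_
  ; _⊗_      = ℚ._*_
  ; ⊖_       = ℚ.-_
  ; rational = λ r → r
  ; ι        = fromℚ
  ; ⊕-homo   = λ _ _ → pointwise λ _ → refl
  ; ⊗-homo   = λ _ _ → pointwise λ _ → refl
  ; ⊖-homo   = λ _ → pointwise λ _ → refl
  ; rational-homo = λ _ → ℛ.refl
  ; Zero     = _≡ 0ℚ
  ; NonZero  = _≢ 0ℚ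
  ; zero?    = ℚ._≟ 0ℚ
  ; nonZero? = λ a → ¬? (a ℚ.≟ 0ℚ)
  ; zero⇒≈0    = λ { refl → ℛ.refl }
  ; nonZero⇒≉0 = fromℚ-≉0
  }

-- A pair (a , b) stands for a + b s, where s² = n; it is nonzero as soon as
-- its norm (a + b s)(a − b s) = a² − n b² is.
adjoin : (K : RealSubring) (n : RealSubring.Carrier K) (s : ℝ) →
         s *ℝ s ≈ℝ RealSubring.ι K n → RealSubring
adjoin K n s s²≈n = record
  { Carrier  = Carrier × Carrier
  ; _⊕_      = λ (a , b) (a′ , b′) → a ⊕ a′ , b ⊕ b′
  ; _⊗_      = λ (a , b) (a′ , b′) → a ⊗ a′ ⊕ n ⊗ (b ⊗ b′) , a ⊗ b′ ⊕ b ⊗ a′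
  ; ⊖_       = λ (a , b) → ⊖ a , ⊖ b
  ; rational = λ r → rational r , rational 0ℚ
  ; ι        = λ (a , b) → ι a +ℝ ι b *ℝ s
  ; ⊕-homo   = λ (a , b) (a′ , b′) → begin
      (ι a +ℝ ι b *ℝ s) +ℝ (ι a′ +ℝ ι b′ *ℝ s)
        ≈⟨ solve 5 (λ a b a′ b′ s → (a :+ b :* s) :+ (a′ :+ b′ :* s)
                               := (a :+ a′) :+ (b :+ b′) :* s)
             ℛ.refl (ι a) (ι b) (ι a′) (ι b′) s ⟩
      (ι a +ℝ ι a′) +ℝ (ι b +ℝ ι b′) *ℝ s
        ≈⟨ ℛ.+-cong (⊕-homo a a′) (ℛ.*-congʳ (⊕-homo b b′)) ⟩
      ι (a ⊕ a′) +ℝ ι (b ⊕ b′) *ℝ s ∎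
  ; ⊗-homo   = λ (a , b) (a′ , b′) → begin
      (ι a +ℝ ι b *ℝ s) *ℝ (ι a′ +ℝ ι b′ *ℝ s)
        -- The solver treats `s` as a free variable, so `s * s` is kept as an isolated factor, which
        -- the next step replaces by `n`.
        ≈⟨ solve 5 (λ a b a′ b′ s → (a :+ b :* s) :* (a′ :+ b′ :* s)
                               := (a :* a′ :+ (s :* s) :* (b :* b′)) :+ (a :* b′ :+ b :* a′) :* s)
             ℛ.refl (ι a) (ι b) (ι a′) (ι b′) s ⟩
      (ι a *ℝ ι a′ +ℝ (s *ℝ s) *ℝ (ι b *ℝ ι b′)) +ℝ (ι a *ℝ ι b′ +ℝ ι b *ℝ ι a′) *ℝ s
        ≈⟨ ℛ.+-cong
             (ι-sum (⊗-homo a a′) (ι-product s²≈n (⊗-homo b b′)))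
             (ℛ.*-congʳ (ι-sum (⊗-homo a b′) (⊗-homo b a′))) ⟩
      ι (a ⊗ a′ ⊕ n ⊗ (b ⊗ b′)) +ℝ ι (a ⊗ b′ ⊕ b ⊗ a′) *ℝ s ∎
  ; ⊖-homo   = λ (a , b) → begin
      -ℝ (ι a +ℝ ι b *ℝ s)
        ≈⟨ solve 3 (λ a b s → :- (a :+ b :* s) := (:- a) :+ (:- b) :* s)
             ℛ.refl (ι a) (ι b) s ⟩
      (-ℝ ι a) +ℝ (-ℝ ι b) *ℝ s
        ≈⟨ ℛ.+-cong (⊖-homo a) (ℛ.*-congʳ (⊖-homo b)) ⟩
      ι (⊖ a) +ℝ ι (⊖ b) *ℝ s ∎
  ; rational-homo = λ r → begin
      fromℚ r
        ≈⟨ solve 2 (λ r s → r := r :+ con 0ℚ :* s) ℛ.refl (fromℚ r) s ⟩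
      fromℚ r +ℝ 0ℝ *ℝ s
        ≈⟨ ℛ.+-cong (rational-homo r) (ℛ.*-congʳ (rational-homo 0ℚ)) ⟩
      ι (rational r) +ℝ ι (rational 0ℚ) *ℝ s ∎
  ; Zero     = λ (a , b) → Zero a × Zero b
  ; NonZero  = λ (a , b) → NonZero (norm a b)
  ; zero?    = λ (a , b) → zero? a ×-dec zero? b
  ; nonZero? = λ (a , b) → nonZero? (norm a b)
  ; zero⇒≈0  = λ {(a , b)} (a≈0 , b≈0) → begin
      ι a +ℝ ι b *ℝ s  ≈⟨ ℛ.+-cong (zero⇒≈0 a≈0) (ℛ.*-congʳ (zero⇒≈0 b≈0)) ⟩
      0ℝ +ℝ 0ℝ *ℝ s    ≈⟨ solve 1 (λ s → con 0ℚ :+ con 0ℚ :* s := con 0ℚ) ℛ.refl s ⟩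
      0ℝ               ∎
  ; nonZero⇒≉0 = λ {(a , b)} norm≉0 a+bs≈0 → nonZero⇒≉0 norm≉0 (begin
      ι (norm a b)
        ≈⟨ ι-sum (⊗-homo a a)
             (ι-negation (ι-product s²≈n (⊗-homo b b))) ⟨
      ι a *ℝ ι a +ℝ (-ℝ ((s *ℝ s) *ℝ (ι b *ℝ ι b)))
        ≈⟨ solve 3 (λ a b s → a :* a :+ (:- ((s :* s) :* (b :* b)))
                           := (a :+ b :* s) :* (a :- b :* s))
             ℛ.refl (ι a) (ι b) s ⟩
      (ι a +ℝ ι b *ℝ s) *ℝ (ι a -ℝ ι b *ℝ s)
        ≈⟨ ℛ.*-congʳ a+bs≈0 ⟩
      0ℝ *ℝ (ι a -ℝ ι b *ℝ s)
        ≈⟨ ℛ.zeroˡ _ ⟩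
      0ℝ ∎)
  }
  where
  open RealSubring K
  open ℝ-Solver
  open SetoidReasoning ℛ.setoid

  norm : Carrier → Carrier → Carrier
  norm a b = a ⊗ a ⊕ ⊖ (n ⊗ (b ⊗ b))

-- An element ((a , b) , (c , d)) of the second ring stands for a + b√2 + (c + d√2)√14.
ℚ[√2] ℚ[√2,√14] : RealSubring
ℚ[√2]     = adjoin rationals (+ 2 ℚ./ 1) (√ 2) (Real.√-square 2)
ℚ[√2,√14] = adjoin ℚ[√2] (+ 14 ℚ./ 1 , 0ℚ) (√ 14)
  (ℛ.trans (Real.√-square 14) (RealSubring.rational-homo ℚ[√2] (+ 14 ℚ./ 1)))

-- Complex numbers with exact real and imaginary parts

module ExactArithmetic (K : RealSubring) where

  private module K = RealSubring K

  -- The number z is an index rather than a field: it is then syntactically the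
  -- entry of vector it represents, and comparing the two unfolds no arithmetic on
  -- Cauchy sequences.
  record Exact (z : ℂ) : Set where
    constructor exactly
    field
      reᵉ imᵉ : K.Carrier
      re≈     : re z ≈ℝ K.ι reᵉ
      im≈     : im z ≈ℝ K.ι imᵉ

  open Exact

  infix  8 ⊖_
  infixl 7 _⊗_
  infixl 6 _⊕_ _⊝_

  _⊕_ : ∀ {z w} → Exact z → Exact w → Exact (z + w)
  exactly a b a≈ b≈ ⊕ exactly a′ b′ a′≈ b′≈ =
    exactly (a K.⊕ a′) (b K.⊕ b′) (K.ι-sum a≈ a′≈) (K.ι-sum b≈ b′≈)

  ⊖_ : ∀ {z} → Exact z → Exact (- z)
  ⊖ exactly a b a≈ b≈ = exactly (K.⊖ a) (K.⊖ b) (K.ι-negation a≈) (K.ι-negation b≈)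

  _⊝_ : ∀ {z w} → Exact z → Exact w → Exact (z - w)
  x ⊝ y = x ⊕ (⊖ y)

  _⊗_ : ∀ {z w} → Exact z → Exact w → Exact (z * w)
  exactly a b a≈ b≈ ⊗ exactly a′ b′ a′≈ b′≈ = exactly
    (a K.⊗ a′ K.⊕ K.⊖ (b K.⊗ b′)) (a K.⊗ b′ K.⊕ b K.⊗ a′)
    (K.ι-sum (K.ι-product a≈ a′≈) (K.ι-negation (K.ι-product b≈ b′≈)))
    (K.ι-sum (K.ι-product a≈ b′≈) (K.ι-product b≈ a′≈))

  conjᵉ : ∀ {z} → Exact z → Exact (conj z)
  conjᵉ (exactly a b a≈ b≈) = exactly a (K.⊖ b) a≈ (K.ι-negation b≈)

  0ᵉ : Exact 0ℂ
  0ᵉ = exactly (K.rational 0ℚ) (K.rational 0ℚ) (K.rational-homo 0ℚ) (K.rational-homo 0ℚ)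

  1ᵉ : Exact 1ℂ
  1ᵉ = exactly (K.rational 1ℚ) (K.rational 0ℚ) (K.rational-homo 1ℚ) (K.rational-homo 0ℚ)

  iᵉ : Exact 𝕚
  iᵉ = exactly (K.rational 0ℚ) (K.rational 1ℚ) (K.rational-homo 0ℚ) (K.rational-homo 1ℚ)

  IsZero NonZero : ∀ {z} → Pred (Exact z) 0ℓ
  IsZero  x = K.Zero (reᵉ x) × K.Zero (imᵉ x)
  NonZero x = K.NonZero (reᵉ x) ⊎ K.NonZero (imᵉ x)

  isZero? : ∀ {z} → Decidable (IsZero {z})
  isZero? x = K.zero? (reᵉ x) ×-dec K.zero? (imᵉ x)

  nonZero? : ∀ {z} → Decidable (NonZero {z})
  nonZero? x = K.nonZero? (reᵉ x) ⊎-dec K.nonZero? (imᵉ x)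

  isZero⇒≈0 : ∀ {z} (x : Exact z) → IsZero x → z ≈ 0ℂ
  isZero⇒≈0 x (re≈0 , im≈0) =
    ℛ.trans (re≈ x) (K.zero⇒≈0 re≈0) , ℛ.trans (im≈ x) (K.zero⇒≈0 im≈0)

  nonZero⇒≉0 : ∀ {z} (x : Exact z) → NonZero x → ¬ (z ≈ 0ℂ)
  nonZero⇒≉0 x (inj₁ re≉0) (re≈0 , _) = K.nonZero⇒≉0 re≉0 (ℛ.trans (ℛ.sym (re≈ x)) re≈0)
  nonZero⇒≉0 x (inj₂ im≉0) (_ , im≈0) = K.nonZero⇒≉0 im≉0 (ℛ.trans (ℛ.sym (im≈ x)) im≈0)

  ExactNumber : Set
  ExactNumber = ∃[ z ] Exact z

  values : ∀ {d} → Vec ExactNumber d → Vector ℂ d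
  values []             = Vector.[]
  values ((z , _) ∷ xs) = z Vector.∷ values xs

  entry : ∀ {d} (xs : Vec ExactNumber d) k → Exact (values xs k)
  entry ((_ , x) ∷ _) zero    = x
  entry (_ ∷ xs)      (suc k) = entry xs k

  -- The recursion follows the fold in ⟨_,_⟩, so the indices agree by computation.
  inner : ∀ {d} (xs ys : Vec ExactNumber d) → Exact ⟨ values xs , values ys ⟩
  inner []             []             = 0ᵉ
  inner ((_ , x) ∷ xs) ((_ , y) ∷ ys) = conjᵉ x ⊗ y ⊕ inner xs ys

  minor : ∀ {d} (xs ys : Vec ExactNumber d) j k →
          Exact (values xs j * values ys k - values xs k * values ys j)
  minor xs ys j k = entry xs j ⊗ entry ys k ⊝ entry xs k ⊗ entry ys j

open ExactArithmetic ℚ[√2,√14]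

private module K = RealSubring ℚ[√2,√14]

-- The constants √2, p and q in ℚ(√2, √14)

module _ where
  open ℝ-Solver

  ¼ : ℚ
  ¼ = + 1 ℚ./ 4

  -- In the identity `s` and `t` stand for √2 and √14; its right side is `ι` written out through
  -- both adjunctions.
  √2ᵉ : Exact √2
  √2ᵉ = exactly ((0ℚ , 1ℚ) , (0ℚ , 0ℚ)) (K.rational 0ℚ)
    (solve 2 (λ s t → s := (con 0ℚ :+ con 1ℚ :* s) :+ (con 0ℚ :+ con 0ℚ :* s) :* t)
      ℛ.refl (√ 2) (√ 14))
    (K.rational-homo 0ℚ)

  pᵉ : Exact p
  pᵉ = exactly ((0ℚ , ¼) , (¼ , 0ℚ)) (K.rational 0ℚ)
    (solve 2 (λ s t → (t :+ s) :* con ¼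
                   := (con 0ℚ :+ con ¼ :* s) :+ (con ¼ :+ con 0ℚ :* s) :* t)
      ℛ.refl (√ 2) (√ 14))
    (K.rational-homo 0ℚ)

  qᵉ : Exact q
  qᵉ = exactly ((0ℚ , ℚ.- ¼) , (¼ , 0ℚ)) (K.rational 0ℚ)
    (solve 2 (λ s t → (t :- s) :* con ¼
                   := (con 0ℚ :+ con (ℚ.- ¼) :* s) :+ (con ¼ :+ con 0ℚ :* s) :* t)
      ℛ.refl (√ 2) (√ 14))
    (K.rational-homo 0ℚ)

-- Rays

-‿cong : ∀ {z w} → z ≈ w → - z ≈ - w
-‿cong (re≈ , im≈) = ℛ.-‿cong re≈ , ℛ.-‿cong im≈

+-cong : ∀ {z z′ w w′} → z ≈ z′ → w ≈ w′ → z + w ≈ z′ + w′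
+-cong (re≈ , im≈) (re≈′ , im≈′) = ℛ.+-cong re≈ re≈′ , ℛ.+-cong im≈ im≈′

*-congˡ : ∀ z {w w′} → w ≈ w′ → z * w ≈ z * w′
*-congˡ _ (re≈ , im≈) =
  ℛ.+-cong (ℛ.*-congˡ re≈) (ℛ.-‿cong (ℛ.*-congˡ im≈)) ,
  ℛ.+-cong (ℛ.*-congˡ im≈) (ℛ.*-congˡ re≈)

≈-trans : ∀ {z w v} → z ≈ w → w ≈ v → z ≈ v
≈-trans (re≈ , im≈) (re≈′ , im≈′) = ℛ.trans re≈ re≈′ , ℛ.trans im≈ im≈′

-- Commutativity of complex multiplication, checked as two polynomial identities in the six real
-- coordinates.
minor-multiple : ∀ z x y → x * (z * y) - y * (z * x) ≈ 0ℂ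
minor-multiple (a +i b) (s +i t) (u +i w) =
  solve 6 (λ a b s t u w →
      (s :* (a :* u :- b :* w) :- t :* (a :* w :+ b :* u))
      :+ (:- (u :* (a :* s :- b :* t) :- w :* (a :* t :+ b :* s)))
      := con 0ℚ) ℛ.refl a b s t u w ,
  solve 6 (λ a b s t u w →
      (s :* (a :* w :+ b :* u) :+ t :* (a :* u :- b :* w))
      :+ (:- (u :* (a :* t :+ b :* s) :+ w :* (a :* s :- b :* t)))
      := con 0ℚ) ℛ.refl a b s t u w
  where open ℝ-Solver

∈-ray : ∀ {d} (x : Vector ℂ d) → ray x x
∈-ray x = 1ℂ , λ k →
  solve 2 (λ a b → a := con 1ℚ :* a :- con 0ℚ :* b) ℛ.refl (re (x k)) (im (x k)) ,
  solve 2 (λ a b → b := con 1ℚ :* b :+ con 0ℚ :* a) ℛ.refl (re (x k)) (im (x k))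
  where open ℝ-Solver

-- Substituting y = z x turns the minor into x_j (z x_k) - x_k (z x_j).
ray⇒minors-vanish : ∀ {d} {x y : Vector ℂ d} → ray x y →
                    ∀ j k → x j * y k - x k * y j ≈ 0ℂ
ray⇒minors-vanish {x = x} (z , y≈zx) j k = ≈-trans
  (+-cong (*-congˡ (x j) (y≈zx k)) (-‿cong (*-congˡ (x k) (y≈zx j))))
  (minor-multiple z (x j) (x k))

-- The representation of H₂₁

[_⨾_⨾_]ᵉ : ∀ {x y z} → Exact x → Exact y → Exact z → Vec ExactNumber 3
[ x ⨾ y ⨾ z ]ᵉ = (_ , x) ∷ (_ , y) ∷ (_ , z) ∷ []

-- Each entry repeats the corresponding expression of `vector` operator by operator, with matching
-- precedences, so its inferred index is that very expression.
vectorᵉ : V₂₁ → Vec ExactNumber 3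
vectorᵉ c   = [ 0ᵉ ⨾ 0ᵉ ⨾ 1ᵉ ]ᵉ
vectorᵉ a₁  = [ 1ᵉ ⨾ 1ᵉ ⨾ 0ᵉ ]ᵉ
vectorᵉ a₂  = [ 1ᵉ ⨾ ⊖ 1ᵉ ⨾ 0ᵉ ]ᵉ
vectorᵉ b₁  = [ 1ᵉ ⨾ iᵉ ⨾ 0ᵉ ]ᵉ
vectorᵉ b₂  = [ 1ᵉ ⨾ ⊖ iᵉ ⨾ 0ᵉ ]ᵉ
vectorᵉ v₀  = [ 1ᵉ ⨾ ⊖ 1ᵉ ⨾ √2ᵉ ]ᵉ
vectorᵉ v₄  = [ 1ᵉ ⨾ ⊖ 1ᵉ ⨾ ⊖ √2ᵉ ]ᵉ
vectorᵉ v₁  = [ 1ᵉ ⨾ iᵉ ⨾ pᵉ ⊕ iᵉ ⊗ qᵉ ]ᵉ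
vectorᵉ v₅  = [ 1ᵉ ⨾ iᵉ ⨾ ⊖ pᵉ ⊝ iᵉ ⊗ qᵉ ]ᵉ
vectorᵉ v₂  = [ 1ᵉ ⨾ 1ᵉ ⨾ ⊖ iᵉ ⊗ √2ᵉ ]ᵉ
vectorᵉ v₆  = [ 1ᵉ ⨾ 1ᵉ ⨾ iᵉ ⊗ √2ᵉ ]ᵉ
vectorᵉ v₃  = [ 1ᵉ ⨾ ⊖ iᵉ ⨾ qᵉ ⊝ iᵉ ⊗ pᵉ ]ᵉ
vectorᵉ v₇  = [ 1ᵉ ⨾ ⊖ iᵉ ⨾ ⊖ qᵉ ⊕ iᵉ ⊗ pᵉ ]ᵉ
vectorᵉ v₀₁ = [ ⊖ pᵉ ⊕ iᵉ ⊗ (qᵉ ⊕ √2ᵉ) ⨾ √2ᵉ ⊝ pᵉ ⊕ iᵉ ⊗ qᵉ ⨾ 1ᵉ ⊝ iᵉ ]ᵉ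
vectorᵉ v₁₂ = [ √2ᵉ ⊝ pᵉ ⊕ iᵉ ⊗ qᵉ ⨾ pᵉ ⊝ iᵉ ⊗ (qᵉ ⊕ √2ᵉ) ⨾ 1ᵉ ⊕ iᵉ ]ᵉ
vectorᵉ v₂₃ = [ qᵉ ⊕ √2ᵉ ⊕ iᵉ ⊗ pᵉ ⨾ ⊖ qᵉ ⊕ iᵉ ⊗ (√2ᵉ ⊝ pᵉ) ⨾ ⊖ 1ᵉ ⊕ iᵉ ]ᵉ
vectorᵉ v₃₄ = [ qᵉ ⊕ iᵉ ⊗ (pᵉ ⊝ √2ᵉ) ⨾ qᵉ ⊕ √2ᵉ ⊕ iᵉ ⊗ pᵉ ⨾ ⊖ 1ᵉ ⊝ iᵉ ]ᵉ
vectorᵉ v₄₅ = [ pᵉ ⊝ iᵉ ⊗ (qᵉ ⊕ √2ᵉ) ⨾ ⊖ √2ᵉ ⊕ pᵉ ⊝ iᵉ ⊗ qᵉ ⨾ 1ᵉ ⊝ iᵉ ]ᵉ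
vectorᵉ v₅₆ = [ ⊖ √2ᵉ ⊕ pᵉ ⊝ iᵉ ⊗ qᵉ ⨾ ⊖ pᵉ ⊕ iᵉ ⊗ (qᵉ ⊕ √2ᵉ) ⨾ 1ᵉ ⊕ iᵉ ]ᵉ
vectorᵉ v₆₇ = [ ⊖ qᵉ ⊝ √2ᵉ ⊝ iᵉ ⊗ pᵉ ⨾ qᵉ ⊝ iᵉ ⊗ (√2ᵉ ⊝ pᵉ) ⨾ ⊖ 1ᵉ ⊕ iᵉ ]ᵉ
vectorᵉ v₇₀ = [ ⊖ qᵉ ⊝ iᵉ ⊗ (pᵉ ⊝ √2ᵉ) ⨾ ⊖ qᵉ ⊝ √2ᵉ ⊝ iᵉ ⊗ pᵉ ⨾ ⊖ 1ᵉ ⊝ iᵉ ]ᵉ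

-- The case split lets both sides reduce; `values` then returns the indices, which are the original
-- coordinates.
vector≡values : ∀ v → vector v ≡ values (vectorᵉ v)
vector≡values c   = refl
vector≡values a₁  = refl
vector≡values a₂  = refl
vector≡values b₁  = refl
vector≡values b₂  = refl
vector≡values v₀  = refl
vector≡values v₄  = refl
vector≡values v₁  = refl
vector≡values v₅  = refl
vector≡values v₂  = refl
vector≡values v₆  = refl
vector≡values v₃  = refl
vector≡values v₇  = refl
vector≡values v₀₁ = refl
vector≡values v₁₂ = refl
vector≡values v₂₃ = refl
vector≡values v₃₄ = refl
vector≡values v₄₅ = refl
vector≡values v₅₆ = refl
vector≡values v₆₇ = refl
vector≡values v₇₀ = refl

-- Deciding statements about all vertices

vertices : Vec V₂₁ 21
vertices = v₀ ∷ v₁ ∷ v₂ ∷ v₃ ∷ v₄ ∷ v₅ ∷ v₆ ∷ v₇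
         ∷ v₀₁ ∷ v₁₂ ∷ v₂₃ ∷ v₃₄ ∷ v₄₅ ∷ v₅₆ ∷ v₆₇ ∷ v₇₀
         ∷ a₁ ∷ a₂ ∷ b₁ ∷ b₂ ∷ c ∷ []

-- A section of `lookup vertices`: it reduces quantification over vertices and their equality to
-- `Fin 21`.
position : ∀ v → ∃[ i ] lookup vertices i ≡ v
position v₀  = # 0  , refl
position v₁  = # 1  , refl
position v₂  = # 2  , refl
position v₃  = # 3  , refl
position v₄  = # 4  , refl
position v₅  = # 5  , refl
position v₆  = # 6  , refl
position v₇  = # 7  , refl
position v₀₁ = # 8  , refl
position v₁₂ = # 9  , refl
position v₂₃ = # 10 , refl
position v₃₄ = # 11 , refl
position v₄₅ = # 12 , refl
position v₅₆ = # 13 , refl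
position v₆₇ = # 14 , refl
position v₇₀ = # 15 , refl
position a₁  = # 16 , refl
position a₂  = # 17 , refl
position b₁  = # 18 , refl
position b₂  = # 19 , refl
position c   = # 20 , refl

∀-vertices? : {P : Pred V₂₁ 0ℓ} → Decidable P → Dec (∀ v → P v)
∀-vertices? {P} P? = map′
  (λ every v → let i , eq = position v in ≡.subst P eq (every i))
  (λ every i → every (lookup vertices i))
  (all? (P? ∘ lookup vertices))

_≟_ : DecidableEquality V₂₁
u ≟ v = map′
  (λ eq → ≡.trans (≡.sym (proj₂ (position u)))
            (≡.trans (≡.cong (lookup vertices) eq) (proj₂ (position v))))
  (≡.cong (proj₁ ∘ position))
  (proj₁ (position u) ≟ᶠ proj₁ (position v))

open ThreeUniformHypergraph H₂₁ using (hyperedges; ShareHyperedge)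
open DecMembership _≟_ using (_∈?_)

shareHyperedge? : ∀ u v → Dec (ShareHyperedge u v)
shareHyperedge? u v = map′ List.find (λ (e , e∈ , uv∈e) → List.lose e∈ uv∈e)
  (Any.any? (λ e → (u ∈? e) ×-dec (v ∈? e)) hyperedges)

-- Decidable certificates and their soundness

NonZeroVector : ∀ {d} → Pred (Vec ExactNumber d) 0ℓ
NonZeroVector xs = ∃[ k ] NonZero (entry xs k)

DifferentRays : ∀ {d} (xs ys : Vec ExactNumber d) → Set
DifferentRays xs ys = ∃[ j ] ∃[ k ] NonZero (minor xs ys j k)

-- The tests are one-sided, so the equivalence is certified by both sides holding or both failing.
OrthogonalIff : ∀ {d} → Set → (xs ys : Vec ExactNumber d) → Set
OrthogonalIff A xs ys = (A × IsZero (inner xs ys)) ⊎ (¬ A × NonZero (inner xs ys))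

nonZeroVector : ∀ {d} (xs : Vec ExactNumber d) → NonZeroVector xs → ¬ (values xs ≈ᵛ 0ᵛ)
nonZeroVector xs (k , nonZero) xs≈0 = nonZero⇒≉0 (entry xs k) nonZero (xs≈0 k)

-- If the rays agreed, y would lie in the ray of x and every minor would vanish.
differentRays : ∀ {d} (xs ys : Vec ExactNumber d) → DifferentRays xs ys →
                ¬ (ray (values xs) ≐ ray (values ys))
differentRays xs ys (j , k , nonZero) (_ , ⊇) = nonZero⇒≉0 (minor xs ys j k) nonZero
  (ray⇒minors-vanish {x = values xs} (⊇ (∈-ray (values ys))) j k)

orthogonalIff : ∀ {d A} (xs ys : Vec ExactNumber d) → OrthogonalIff A xs ys →
                ⟨ values xs , values ys ⟩ ≈ 0ℂ ⇔ A
orthogonalIff xs ys (inj₁ (a , isZero)) = mk⇔ (λ _ → a) (λ _ → isZero⇒≈0 (inner xs ys) isZero)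
orthogonalIff xs ys (inj₂ (¬a , nonZero)) = mk⇔
  (λ ≈0 → contradiction ≈0 (nonZero⇒≉0 (inner xs ys) nonZero)) (λ a → contradiction a ¬a)

nonZeroVectors : ∀ v → NonZeroVector (vectorᵉ v)
nonZeroVectors = from-yes (∀-vertices? λ v → any? λ k → nonZero? (entry (vectorᵉ v) k))

-- `from-yes` runs the test during type checking. The alternative u = v covers the diagonal, where
-- all minors vanish.
differentRaysOrEqual : ∀ u v → u ≡ v ⊎ DifferentRays (vectorᵉ u) (vectorᵉ v)
differentRaysOrEqual = from-yes (∀-vertices? λ u → ∀-vertices? λ v →
  (u ≟ v) ⊎-dec (any? λ j → any? λ k → nonZero? (minor (vectorᵉ u) (vectorᵉ v) j k)))

-- The diagonal is set apart because a vertex shares a hyperedge with itself while its vector is not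
-- self-orthogonal.
orthogonalIffOrEqual : ∀ u v → u ≡ v ⊎ OrthogonalIff (ShareHyperedge u v) (vectorᵉ u) (vectorᵉ v)
orthogonalIffOrEqual = from-yes (∀-vertices? λ u → ∀-vertices? λ v →
  let shared = shareHyperedge? u v
      u·v    = inner (vectorᵉ u) (vectorᵉ v)
  in (u ≟ v) ⊎-dec ((shared ×-dec isZero? u·v) ⊎-dec (¬? shared ×-dec nonZero? u·v)))

unlessEqual : ∀ {u v : V₂₁} {A : Set} → u ≢ v → u ≡ v ⊎ A → A
unlessEqual u≢v = [ (λ u≡v → contradiction u≡v u≢v) , (λ a → a) ]′

theorem6 : IsFaithfulOrthogonalRepresentation H₂₁ ≤-refl vector
theorem6 = record
  -- For a variable `v` neither `vector v` nor `vectorᵉ v` reduces, so each field is transported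
  -- along `vector≡values`.
  { nonzero       = λ v → ≡.subst (λ x → ¬ (x ≈ᵛ 0ᵛ)) (≡.sym (vector≡values v))
      (nonZeroVector (vectorᵉ v) (nonZeroVectors v))
  ; distinct-rays = λ {u} {v} u≢v →
      ≡.subst₂ (λ x y → ¬ (ray x ≐ ray y)) (≡.sym (vector≡values u)) (≡.sym (vector≡values v))
        (differentRays (vectorᵉ u) (vectorᵉ v) (unlessEqual u≢v (differentRaysOrEqual u v)))
  ; orthogonality = λ {u} {v} u≢v →
      ≡.subst₂ (λ x y → ⟨ x , y ⟩ ≈ 0ℂ ⇔ ShareHyperedge u v)
        (≡.sym (vector≡values u)) (≡.sym (vector≡values v))
        (orthogonalIff (vectorᵉ u) (vectorᵉ v) (unlessEqual u≢v (orthogonalIffOrEqual u v)))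
  }
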